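{- The additive cut rule is admissible in $\mathsf{G4KM}$: for all finite multisets of formulas $\Gamma,\Delta$ and every formula $\varphi$, if $\Gamma\Rightarrow\Delta,\varphi$ and $\Gamma,\varphi\Rightarrow\Delta$ are provable in $\mathsf{G4KM}$, then $\Gamma\Rightarrow\Delta$ is provable in $\mathsf{G4KM}$.
   Context: Let $\mathsf{Prop}$ be a countably infinite set of propositional variables with decidable equality. Formulas: $\varphi ::= p\in\mathsf{Prop}\mid\bot\mid\varphi\land\varphi\mid\varphi\lor\varphi\mid\varphi\to\varphi\mid\Box\varphi$. $\Gamma,\Delta,\dots$ denote finite multisets of formulas; $\Gamma,\Delta$ denotes multiset sum, and a formula is identified with the singleton multiset. $\Box^{ -1}\Gamma$ is the multiset obtained from $\Gamma$ by replacing each boxed formula $\Box\gamma$ by $\gamma$ (removing one outermost box) and keeping all formulas whose main connective is not $\Box$. A sequent is an expression $\Gamma\Rightarrow\Delta$ with $\Gamma,\Delta$ finite multisets of formulas. The calculus $\mathsf{G4KM}$ has the following rules ($p$ a propositional variable; premises before "/", conclusion after): - ($\bot$L): / $\Gamma,\bot\Rightarrow\Delta$ - (IdP): / $\Gamma,p\Rightarrow p,\Delta$ - ($\land$L): $\Gamma,\varphi,\psi\Rightarrow\Delta$ / $\Gamma,\varphi\land\psi\Rightarrow\Delta$ - ($\land$R): $\Gamma\Rightarrow\varphi,\Delta$ and $\Gamma\Rightarrow\psi,\Delta$ / $\Gamma\Rightarrow\varphi\land\psi,\Delta$ - ($\lor$L): $\Gamma,\varphi\Rightarrow\Delta$ and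 $\Gamma,\psi\Rightarrow\Delta$ / $\Gamma,\varphi\lor\psi\Rightarrow\Delta$ - ($\lor$R): $\Gamma\Rightarrow\varphi,\psi,\Delta$ / $\Gamma\Rightarrow\varphi\lor\psi,\Delta$ - ($\land\!\to$L): $\Gamma,\varphi\to(\psi\to\chi)\Rightarrow\Delta$ / $\Gamma,(\varphi\land\psi)\to\chi\Rightarrow\Delta$ - ($\lor\!\to$L): $\Gamma,\varphi\to\chi,\psi\to\chi\Rightarrow\Delta$ / $\Gamma,(\varphi\lor\psi)\to\chi\Rightarrow\Delta$ - ($p\!\to$L): $\Gamma,p,\varphi\Rightarrow\Delta$ / $\Gamma,p,p\to\varphi\Rightarrow\Delta$ - ($\Box$R): $\Box^{ -1}\Gamma,\Box\varphi\Rightarrow\varphi$ / $\Gamma\Rightarrow\Box\varphi,\Delta$ - ($\Box\!\to$L): $\Box^{ -1}\Gamma,\Box\varphi,\psi\Rightarrow\varphi$ and $\Gamma,\psi\Rightarrow\Delta$ / $\Gamma,\Box\varphi\to\psi\Rightarrow\Delta$ - ($\to$R): $\Gamma,\varphi\Rightarrow\psi,\Delta$ and $\Box^{ -1}\Gamma,\varphi\Rightarrow\psi$ / $\Gamma\Rightarrow\varphi\to\psi,\Delta$ - ($\to\!\to$L): $\Gamma,\chi\to\psi,\varphi\Rightarrow\Delta,\chi$ and $\Box^{ -1}\Gamma,\chi\to\psi,\varphi\Rightarrow\chi$ and $\Gamma,\psi\Rightarrow\Delta$ / $\Gamma,(\varphi\to\chi)\to\psi\Rightarrow\Delta$ A sequent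 is provable if it is the root of a finite derivation tree built from these rules. -}

module Defs where

open import Data.List.Base using (List; []; _∷_; map)
open import Data.List.Relation.Unary.All using (All)
open import Data.List.Relation.Binary.Permutation.Propositional using (_↭_)
open import Data.Product.Base using (_×_)

infix  9 □_
infixr 8 _∧_
infixr 7 _∨_
infixr 6 _⊃_
infix  4 _⇒_ _≈_

data Formula (Var : Set) : Set where
  var         : Var → Formula Var
  ⊥           : Formula Var
  _∧_ _∨_ _⊃_ : (φ ψ : Formula Var) → Formula Var
  □_          : (φ : Formula Var) → Formula Var

-- Finite multisets are lists considered up to permutation; the formula order
-- is made irrelevant in `_≈_` and `Provable` below.
Multiset : Set → Set
Multiset Var = List (Formula Var)

-- Removes exactly one outermost box, if there is one.
unbox : ∀ {Var} → Formula Var → Formula Var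
unbox (□ φ) = φ
unbox φ     = φ

□⁻¹ : ∀ {Var} → Multiset Var → Multiset Var
□⁻¹ = map unbox

record Sequent (Var : Set) : Set where
  constructor _⇒_
  field
    antecedent : Multiset Var
    succedent  : Multiset Var

_≈_ : ∀ {Var} → Sequent Var → Sequent Var → Set
(Γ ⇒ Δ) ≈ (Γ′ ⇒ Δ′) = Γ ↭ Γ′ × Δ ↭ Δ′

private
  variable
    Var   : Set
    p     : Var
    φ ψ χ : Formula Var
    Γ Δ   : Multiset Var

-- `Rule premises conclusion`: the rule instances of G4KM, written on list
-- representatives, with the displayed formulas at the front.
data Rule {Var : Set} : List (Sequent Var) → Sequent Var → Set where

  ⊥L  : Rule [] (⊥ ∷ Γ ⇒ Δ)

  IdP : Rule [] (var p ∷ Γ ⇒ var p ∷ Δ)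

  ∧L  : Rule ((φ ∷ ψ ∷ Γ ⇒ Δ) ∷ [])
             (φ ∧ ψ ∷ Γ ⇒ Δ)

  ∧R  : Rule ((Γ ⇒ φ ∷ Δ) ∷ (Γ ⇒ ψ ∷ Δ) ∷ [])
             (Γ ⇒ φ ∧ ψ ∷ Δ)

  ∨L  : Rule ((φ ∷ Γ ⇒ Δ) ∷ (ψ ∷ Γ ⇒ Δ) ∷ [])
             (φ ∨ ψ ∷ Γ ⇒ Δ)

  ∨R  : Rule ((Γ ⇒ φ ∷ ψ ∷ Δ) ∷ [])
             (Γ ⇒ φ ∨ ψ ∷ Δ)

  ∧⊃L : Rule ((φ ⊃ (ψ ⊃ χ) ∷ Γ ⇒ Δ) ∷ [])
             ((φ ∧ ψ) ⊃ χ ∷ Γ ⇒ Δ)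

  ∨⊃L : Rule ((φ ⊃ χ ∷ ψ ⊃ χ ∷ Γ ⇒ Δ) ∷ [])
             ((φ ∨ ψ) ⊃ χ ∷ Γ ⇒ Δ)

  p⊃L : Rule ((var p ∷ φ ∷ Γ ⇒ Δ) ∷ [])
             (var p ∷ var p ⊃ φ ∷ Γ ⇒ Δ)

  □R  : Rule ((□ φ ∷ □⁻¹ Γ ⇒ φ ∷ []) ∷ [])
             (Γ ⇒ □ φ ∷ Δ)

  □⊃L : Rule ((□ φ ∷ ψ ∷ □⁻¹ Γ ⇒ φ ∷ []) ∷ (ψ ∷ Γ ⇒ Δ) ∷ [])
             (□ φ ⊃ ψ ∷ Γ ⇒ Δ)

  ⊃R  : Rule ((φ ∷ Γ ⇒ ψ ∷ Δ) ∷ (φ ∷ □⁻¹ Γ ⇒ ψ ∷ []) ∷ [])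
             (Γ ⇒ φ ⊃ ψ ∷ Δ)

  ⊃⊃L : Rule ((χ ⊃ ψ ∷ φ ∷ Γ ⇒ χ ∷ Δ) ∷ (χ ⊃ ψ ∷ φ ∷ □⁻¹ Γ ⇒ χ ∷ []) ∷ (ψ ∷ Γ ⇒ Δ) ∷ [])
             ((φ ⊃ χ) ⊃ ψ ∷ Γ ⇒ Δ)

-- Finite derivation trees. The `_≈_` argument identifies list representatives
-- of the same multiset sequent; it is not an additional node of the tree.
data Provable {Var : Set} (s : Sequent Var) : Set where
  derive : ∀ {premises conclusion} →
           Rule premises conclusion →
           conclusion ≈ s →
           All Provable premises →
           Provable s

{-# OPTIONS --safe #-}
module Submission where

-- Cut is obtained semantically, from finite Kripke trees for KM.  Each rule is
-- sound, and terminating backward search either proves a sequent or refutes it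
-- at the root of a tree.  A tree refuting Γ ⇒ Δ cannot validate both premises
-- of a cut, so if these are provable then so is Γ ⇒ Δ.

open import Defs
open import Data.Empty using () renaming (⊥ to Empty)
open import Data.Fin.Base using (Fin)
open import Data.Fin.Properties using (all?)
open import Data.List.Base using (List; []; _∷_; [_]; _++_; lookup; map)
open import Data.List.Membership.Propositional using (_∈_)
open import Data.List.Membership.Propositional.Properties using (∈-∃++; ∈-lookup)
open import Data.List.Relation.Binary.Permutation.Propositional using (_↭_; prep; swap; ↭-refl; ↭-sym; ↭-trans)
open import Data.List.Relation.Binary.Permutation.Propositional.Properties using (shift; All-resp-↭; Any-resp-↭; ∈-resp-↭; map⁺)
open import Data.List.Relation.Unary.All as All using (All; []; _∷_)
import Data.List.Relation.Unary.All.Properties as All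
open import Data.List.Relation.Unary.Any as Any using (Any; here; there; any?)
open import Data.List.Relation.Unary.Any.Properties using (lookup-index)
open import Data.Nat.Base using (ℕ; suc; _+_; _*_; _≤_; _<_; z≤n)
open import Data.Nat.Induction using (<-wellFounded)
open import Data.Nat.ListAction using (sum)
open import Data.Nat.ListAction.Properties using (sum-↭)
open import Data.Nat.Properties using (≤-refl; ≤-reflexive; ≤-trans; <-≤-trans; m≤m+n; m≤n+m; +-mono-≤; +-mono-<-≤; *-monoʳ-≤; module ≤-Reasoning)
open import Data.Nat.Tactic.RingSolver using (solve-∀)
open import Data.Product.Base using (∃; _×_; _,_; proj₁; proj₂) renaming (map₂ to ×-map₂)
open import Data.Sum.Base using (_⊎_; inj₁; inj₂; map₂)
open import Function.Base using (_∘_; const)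
open import Function.Bundles using (_⤖_)
open import Induction.WellFounded using (Acc; acc)
open import Relation.Binary.Definitions using (DecidableEquality)
open import Relation.Binary.PropositionalEquality using (_≡_; refl; sym; trans; cong; cong₂; subst)
open import Relation.Nullary using (¬_; Dec; yes; no; contradiction; map′; _×-dec_; _⊎-dec_; _→-dec_)

-- Kripke trees

-- Finite branching makes forcing decidable; recursion on the tree is the well-founded induction
-- behind Löb's principle.
data Tree (Var : Set) : Set where
  node : (Γ : Multiset Var) {n : ℕ} (children : Fin n → Tree Var) → Tree Var

infix 4 _⊩_ _⊩*_ _≺_

-- A variable is forced at a node only if it labels all nodes above, so that
-- persistence holds on every tree; by persistence, it also suffices that □ φ
-- looks at the immediate successors.
_⊩_ : ∀ {Var} → Tree Var → Formula Var → Set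
node Γ f       ⊩ var p = var p ∈ Γ × (∀ i → f i ⊩ var p)
node _ _       ⊩ ⊥     = Empty
t@(node _ _)   ⊩ φ ∧ ψ = t ⊩ φ × t ⊩ ψ
t@(node _ _)   ⊩ φ ∨ ψ = t ⊩ φ ⊎ t ⊩ ψ
t@(node _ f)   ⊩ φ ⊃ ψ = (t ⊩ φ → t ⊩ ψ) × (∀ i → f i ⊩ φ ⊃ ψ)
node _ f       ⊩ □ φ   = ∀ i → f i ⊩ φ

_⊩*_ : ∀ {Var} → Tree Var → Multiset Var → Set
t ⊩* Γ = All (t ⊩_) Γ

Valid : ∀ {Var} → Sequent Var → Set
Valid (Γ ⇒ Δ) = ∀ t → t ⊩* Γ → Any (t ⊩_) Δ

Refutes : ∀ {Var} → Sequent Var → Tree Var → Set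
Refutes (Γ ⇒ Δ) t = t ⊩* Γ × All (λ φ → ¬ t ⊩ φ) Δ

private
  variable
    Var       : Set
    φ ψ χ     : Formula Var
    Γ Γ′ Δ Δ′ : Multiset Var
    s s′      : Sequent Var

-- Persistence and forcing laws

persistent : ∀ (φ : Formula Var) {n} {f : Fin n → Tree Var} →
             node Γ f ⊩ φ → ∀ i → f i ⊩ φ
□-persistent : ∀ (φ : Formula Var) t → t ⊩ φ → t ⊩ □ φ
persistent (var p) (_ , h)  i = h i
-- Forcing unfolds only at a `node`, so `f i` is abstracted together with the facts about it.
persistent (φ ∧ ψ) {f = f} (a , b) i with f i | persistent φ a i | persistent ψ b i
... | node _ _ | a′ | b′ = a′ , b′
persistent (φ ∨ ψ) {f = f} (inj₁ a) i with f i | persistent φ a i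
... | node _ _ | a′ = inj₁ a′
persistent (φ ∨ ψ) {f = f} (inj₂ b) i with f i | persistent ψ b i
... | node _ _ | b′ = inj₂ b′
persistent (φ ⊃ ψ) (_ , h)  i = h i
persistent (□ φ) {f = f} h i = □-persistent φ (f i) (h i)
□-persistent φ (node _ _) h = persistent φ h

persistent* : ∀ {n} {f : Fin n → Tree Var} → node Γ′ f ⊩* Γ → ∀ i → f i ⊩* Γ
persistent* γ i = All.map (λ {φ} h → persistent φ h i) γ

-- Strictly above a node, a boxed formula sheds its box and any other persists. This justifies
-- `□⁻¹ Γ` in the modal premises.
persistent-unbox : ∀ (φ : Formula Var) {n} {f : Fin n → Tree Var} →
                   node Γ f ⊩ φ → ∀ i → f i ⊩ unbox φ
persistent-unbox (□ φ)   h = h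
persistent-unbox (var p) = persistent (var p)
persistent-unbox ⊥       ()
persistent-unbox (φ ∧ ψ) = persistent (φ ∧ ψ)
persistent-unbox (φ ∨ ψ) = persistent (φ ∨ ψ)
persistent-unbox (φ ⊃ ψ) = persistent (φ ⊃ ψ)

persistent-□⁻¹ : ∀ {n} {f : Fin n → Tree Var} → node Γ′ f ⊩* Γ → ∀ i → f i ⊩* □⁻¹ Γ
persistent-□⁻¹ γ i = All.map⁺ (All.map (λ {φ} h → persistent-unbox φ h i) γ)

-- The hypothesis covers every tree forcing the persistent `Γ`, so recursion can reuse it at each
-- descendant.
⊃-intro : (∀ t → t ⊩* Γ → t ⊩ φ → t ⊩ ψ) → ∀ t → t ⊩* Γ → t ⊩ φ ⊃ ψ
⊃-intro h t@(node _ f) γ = h t γ , λ i → ⊃-intro h (f i) (persistent* γ i)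

⊃-elim : ∀ t → t ⊩ φ ⊃ ψ → t ⊩ φ → t ⊩ ψ
⊃-elim (node _ _) = proj₁

∧-intro : ∀ t → t ⊩ φ → t ⊩ ψ → t ⊩ φ ∧ ψ
∧-intro (node _ _) = _,_

∨-introˡ : ∀ t → t ⊩ φ → t ⊩ φ ∨ ψ
∨-introˡ (node _ _) = inj₁

∨-introʳ : ∀ t → t ⊩ ψ → t ⊩ φ ∨ ψ
∨-introʳ (node _ _) = inj₂

∨-elim : ∀ t → t ⊩ φ ∨ ψ → t ⊩ φ ⊎ t ⊩ ψ
∨-elim (node _ _) h = h

-- Induction from the leaves: the recursive calls at the children together are `t ⊩ □ φ`.
löb : (∀ t → t ⊩* Γ → t ⊩ □ φ → t ⊩ φ) → ∀ t → t ⊩* Γ → t ⊩ φ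
löb h t@(node _ f) γ = h t γ λ i → löb h (f i) (persistent* γ i)

⊃-const : ∀ t → t ⊩ ψ → t ⊩ φ ⊃ ψ
⊃-const t b = ⊃-intro (λ _ → λ { (b ∷ []) _ → b }) t (b ∷ [])

⊃-curry : ∀ t → t ⊩ (φ ∧ ψ) ⊃ χ → t ⊩ φ ⊃ (ψ ⊃ χ)
⊃-curry t h = ⊃-intro
  (λ t → λ { γ@(_ ∷ []) a → ⊃-intro (λ t → λ { (a ∷ h ∷ []) b → ⊃-elim t h (∧-intro t a b) }) t (a ∷ γ) })
  t (h ∷ [])

⊃-uncurry : ∀ t → t ⊩ φ ⊃ (ψ ⊃ χ) → t ⊩ (φ ∧ ψ) ⊃ χ
⊃-uncurry t h = ⊃-intro
  (λ { t@(node _ _) (h ∷ []) (a , b) → ⊃-elim t (⊃-elim t h a) b }) t (h ∷ [])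

∨-⊃ˡ : ∀ t → t ⊩ (φ ∨ ψ) ⊃ χ → t ⊩ φ ⊃ χ
∨-⊃ˡ t h = ⊃-intro (λ t → λ { (h ∷ []) a → ⊃-elim t h (∨-introˡ t a) }) t (h ∷ [])

∨-⊃ʳ : ∀ t → t ⊩ (φ ∨ ψ) ⊃ χ → t ⊩ ψ ⊃ χ
∨-⊃ʳ t h = ⊃-intro (λ t → λ { (h ∷ []) b → ⊃-elim t h (∨-introʳ t b) }) t (h ∷ [])

∨-⊃ : ∀ t → t ⊩ φ ⊃ χ → t ⊩ ψ ⊃ χ → t ⊩ (φ ∨ ψ) ⊃ χ
∨-⊃ t h k = ⊃-intro
  (λ { t@(node _ _) (h ∷ k ∷ []) (inj₁ a) → ⊃-elim t h a
     ; t@(node _ _) (h ∷ k ∷ []) (inj₂ b) → ⊃-elim t k b }) t (h ∷ k ∷ [])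

⊃-⊃-weaken : ∀ t → t ⊩ (φ ⊃ χ) ⊃ ψ → t ⊩ χ ⊃ ψ
⊃-⊃-weaken t h = ⊃-intro (λ t → λ { (h ∷ []) c → ⊃-elim t h (⊃-const t c) }) t (h ∷ [])

-- At the root `φ ⊃ χ` fails. Above it `χ` may hold, but `φ` persists, so there `φ ⊃ χ` gives `χ`
-- and then `ψ`.
⊃-⊃-intro : ∀ t → t ⊩ χ ⊃ ψ → t ⊩ φ → ¬ t ⊩ χ → t ⊩ (φ ⊃ χ) ⊃ ψ
⊃-⊃-intro t@(node _ f) h a ¬c =
  (λ { (k , _) → contradiction (k a) ¬c }) ,
  (λ i → ⊃-intro (λ t → λ { (h ∷ a ∷ []) k → ⊃-elim t h (⊃-elim t k a) })
           (f i) (persistent* (h ∷ a ∷ []) i))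

singleton-valid : ∀ {t : Tree Var} → Any (t ⊩_) [ φ ] → t ⊩ φ
singleton-valid (here h) = h

-- Termination measure: formulas on the right count twice, which pays for the
-- copy of □ φ that □R moves to the left.

weight : Formula Var → ℕ
weight (var _) = 0
weight ⊥       = 0
-- Chosen so that `(φ ∧ ψ) ⊃ χ` outweighs `φ ⊃ (ψ ⊃ χ)`; the inner 2 matches that of the nested
-- implication.
weight (φ ∧ ψ) = suc (weight φ) * suc (2 * suc (weight ψ))
-- The 2 lets `suc (weight (φ ∨ ψ))` exceed `suc (weight φ) + suc (weight ψ)`, as `∨⊃L` duplicates
-- `χ`.
weight (φ ∨ ψ) = 2 + (weight φ + weight ψ)
weight (φ ⊃ ψ) = 2 * (suc (weight φ) * suc (weight ψ))
-- In `□R` the displayed part drops from `2 + 4 * weight φ` to `1 + 4 * weight φ`, the least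
-- possible decrease.
weight (□ φ)   = suc (2 * weight φ)

weights : Multiset Var → ℕ
weights Γ = sum (map weight Γ)

size : Sequent Var → ℕ
size (Γ ⇒ Δ) = weights Γ + 2 * weights Δ

-- Wrapping the inequality in a record lets both sequents be inferred from the type.
record _≺_ {Var : Set} (s s′ : Sequent Var) : Set where
  constructor smaller
  field size-< : size s < size s′

weight-unbox : ∀ (φ : Formula Var) → weight (unbox φ) ≤ weight φ
weight-unbox (□ φ)   = ≤-trans (m≤m+n (weight φ) _) (m≤n+m _ 1)
weight-unbox (var _) = ≤-refl
weight-unbox ⊥       = ≤-refl
weight-unbox (_ ∧ _) = ≤-refl
weight-unbox (_ ∨ _) = ≤-refl
weight-unbox (_ ⊃ _) = ≤-refl

weights-□⁻¹ : ∀ (Γ : Multiset Var) → weights (□⁻¹ Γ) ≤ weights Γ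
weights-□⁻¹ []      = z≤n
weights-□⁻¹ (φ ∷ Γ) = +-mono-≤ (weight-unbox φ) (weights-□⁻¹ Γ)

weights-++ : ∀ (Γ Δ : Multiset Var) → weights (Γ ++ Δ) ≡ weights Γ + weights Δ
weights-++ []      Δ = refl
weights-++ (φ ∷ Γ) Δ = trans (cong (weight φ +_) (weights-++ Γ Δ)) (assoc (weight φ) _ _)
  where
  assoc : ∀ a b c → a + (b + c) ≡ a + b + c
  assoc = solve-∀

weights-↭ : Γ ↭ Γ′ → weights Γ ≡ weights Γ′
weights-↭ π = sum-↭ (map⁺ weight π)

size-≈ : s ≈ s′ → size s ≡ size s′
size-≈ (π , ρ) = cong₂ (λ m n → m + 2 * n) (weights-↭ π) (weights-↭ ρ)

size-++ : ∀ (Γ Γ′ Δ Δ′ : Multiset Var) →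
          size (Γ ++ Γ′ ⇒ Δ ++ Δ′) ≡ size (Γ ⇒ Δ) + size (Γ′ ⇒ Δ′)
size-++ Γ Γ′ Δ Δ′ = trans
  (cong₂ (λ m n → m + 2 * n) (weights-++ Γ Γ′) (weights-++ Δ Δ′))
  (interchange (weights Γ) (weights Γ′) (weights Δ) (weights Δ′))
  where
  interchange : ∀ a b c d → a + b + 2 * (c + d) ≡ a + 2 * c + (b + 2 * d)
  interchange = solve-∀

-- `size` is additive, so comparing displayed formulas is enough. The weak context bounds admit
-- `□⁻¹ Γ` and an emptied succedent.
≺-replace : ∀ Φ Θ Φ₀ Θ₀ {Γ Γ′ Δ Δ′ : Multiset Var} → (Φ ⇒ Θ) ≺ (Φ₀ ⇒ Θ₀) →
            weights Γ′ ≤ weights Γ → weights Δ′ ≤ weights Δ →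
            (Φ ++ Γ′ ⇒ Θ ++ Δ′) ≺ (Φ₀ ++ Γ ⇒ Θ₀ ++ Δ)
≺-replace Φ Θ Φ₀ Θ₀ {Γ} {Γ′} {Δ} {Δ′} (smaller lt) γ δ = smaller (begin-strict
  size (Φ ++ Γ′ ⇒ Θ ++ Δ′)         ≡⟨ size-++ Φ Γ′ Θ Δ′ ⟩
  size (Φ ⇒ Θ) + size (Γ′ ⇒ Δ′)    <⟨ +-mono-<-≤ lt (+-mono-≤ γ (*-monoʳ-≤ 2 δ)) ⟩
  size (Φ₀ ⇒ Θ₀) + size (Γ ⇒ Δ)    ≡⟨ size-++ Φ₀ Γ Θ₀ Δ ⟨
  size (Φ₀ ++ Γ ⇒ Θ₀ ++ Δ)         ∎)
  where open ≤-Reasoning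

-- Naming the difference `k` turns the inequality into a polynomial identity for the ring solver.
slack : ∀ k → suc (size s) + k ≡ size s′ → s ≺ s′
slack k eq = smaller (≤-trans (m≤m+n _ k) (≤-reflexive eq))

-- Decrease of the displayed formulas, rule by rule

∧L-≺ : ∀ (φ ψ : Formula Var) → (φ ∷ ψ ∷ [] ⇒ []) ≺ (φ ∧ ψ ∷ [] ⇒ [])
∧L-≺ φ ψ = slack _ (eq (weight φ) (weight ψ))
  where
  eq : ∀ a b → suc (a + (b + 0) + 2 * 0) + (2 + b + 2 * a + 2 * a * b)
             ≡ suc a * suc (2 * suc b) + 0 + 2 * 0
  eq = solve-∀

∨L-≺ˡ : ∀ (φ ψ : Formula Var) → (φ ∷ [] ⇒ []) ≺ (φ ∨ ψ ∷ [] ⇒ [])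
∨L-≺ˡ φ ψ = slack _ (eq (weight φ) (weight ψ))
  where
  eq : ∀ a b → suc (a + 0 + 2 * 0) + (1 + b) ≡ 2 + (a + b) + 0 + 2 * 0
  eq = solve-∀

∨L-≺ʳ : ∀ (φ ψ : Formula Var) → (ψ ∷ [] ⇒ []) ≺ (φ ∨ ψ ∷ [] ⇒ [])
∨L-≺ʳ φ ψ = slack _ (eq (weight φ) (weight ψ))
  where
  eq : ∀ a b → suc (b + 0 + 2 * 0) + (1 + a) ≡ 2 + (a + b) + 0 + 2 * 0
  eq = solve-∀

∧⊃L-≺ : ∀ (φ ψ χ : Formula Var) →
           (φ ⊃ (ψ ⊃ χ) ∷ [] ⇒ []) ≺ ((φ ∧ ψ) ⊃ χ ∷ [] ⇒ [])
∧⊃L-≺ φ ψ χ = slack _ (eq (weight φ) (weight ψ) (weight χ))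
  where
  eq : ∀ a b c → suc (2 * (suc a * suc (2 * (suc b * suc c))) + 0 + 2 * 0)
                   + (1 + 2 * c + 2 * suc a * c)
               ≡ 2 * (suc (suc a * suc (2 * suc b)) * suc c) + 0 + 2 * 0
  eq = solve-∀

∨⊃L-≺ : ∀ (φ ψ χ : Formula Var) →
           (φ ⊃ χ ∷ ψ ⊃ χ ∷ [] ⇒ []) ≺ ((φ ∨ ψ) ⊃ χ ∷ [] ⇒ [])
∨⊃L-≺ φ ψ χ = slack _ (eq (weight φ) (weight ψ) (weight χ))
  where
  eq : ∀ a b c → suc (2 * (suc a * suc c) + (2 * (suc b * suc c) + 0) + 2 * 0) + (1 + 2 * c)
               ≡ 2 * (suc (2 + (a + b)) * suc c) + 0 + 2 * 0
  eq = solve-∀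

⊃L-≺ : ∀ (φ ψ : Formula Var) → (ψ ∷ [] ⇒ []) ≺ (φ ⊃ ψ ∷ [] ⇒ [])
⊃L-≺ φ ψ = slack _ (eq (weight φ) (weight ψ))
  where
  eq : ∀ a b → suc (b + 0 + 2 * 0) + (1 + b + 2 * a + 2 * a * b)
             ≡ 2 * (suc a * suc b) + 0 + 2 * 0
  eq = solve-∀

□⊃L-≺ : ∀ (φ ψ : Formula Var) →
           (□ φ ∷ ψ ∷ [] ⇒ φ ∷ []) ≺ (□ φ ⊃ ψ ∷ [] ⇒ [])
□⊃L-≺ φ ψ = slack _ (eq (weight φ) (weight ψ))
  where
  eq : ∀ a c → suc (suc (2 * a) + (c + 0) + 2 * (a + 0)) + (2 + 3 * c + 4 * a * c)
             ≡ 2 * (suc (suc (2 * a)) * suc c) + 0 + 2 * 0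
  eq = solve-∀

⊃⊃L-≺ : ∀ (φ χ ψ : Formula Var) →
           (χ ⊃ ψ ∷ φ ∷ [] ⇒ χ ∷ []) ≺ ((φ ⊃ χ) ⊃ ψ ∷ [] ⇒ [])
⊃⊃L-≺ φ χ ψ = slack _ (eq (weight φ) (weight χ) (weight ψ))
  where
  eq : ∀ a b c → suc (2 * (suc b * suc c) + (a + 0) + 2 * (b + 0))
                   + (3 + 4 * c + 2 * b * c + 3 * a + 4 * a * b + 4 * a * c + 4 * a * b * c)
               ≡ 2 * (suc (2 * (suc a * suc b)) * suc c) + 0 + 2 * 0
  eq = solve-∀

∧R-≺ˡ : ∀ (φ ψ : Formula Var) → ([] ⇒ φ ∷ []) ≺ ([] ⇒ φ ∧ ψ ∷ [])
∧R-≺ˡ φ ψ = slack _ (eq (weight φ) (weight ψ))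
  where
  eq : ∀ a b → suc (2 * (a + 0)) + (5 + 4 * b + 4 * a + 4 * a * b)
             ≡ 2 * (suc a * suc (2 * suc b) + 0)
  eq = solve-∀

∧R-≺ʳ : ∀ (φ ψ : Formula Var) → ([] ⇒ ψ ∷ []) ≺ ([] ⇒ φ ∧ ψ ∷ [])
∧R-≺ʳ φ ψ = slack _ (eq (weight φ) (weight ψ))
  where
  eq : ∀ a b → suc (2 * (b + 0)) + (5 + 2 * b + 6 * a + 4 * a * b)
             ≡ 2 * (suc a * suc (2 * suc b) + 0)
  eq = solve-∀

∨R-≺ : ∀ (φ ψ : Formula Var) → ([] ⇒ φ ∷ ψ ∷ []) ≺ ([] ⇒ φ ∨ ψ ∷ [])
∨R-≺ φ ψ = slack _ (eq (weight φ) (weight ψ))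
  where
  eq : ∀ a b → suc (2 * (a + (b + 0))) + 3 ≡ 2 * (2 + (a + b) + 0)
  eq = solve-∀

□R-≺ : ∀ (φ : Formula Var) → (□ φ ∷ [] ⇒ φ ∷ []) ≺ ([] ⇒ □ φ ∷ [])
□R-≺ φ = slack _ (eq (weight φ))
  where
  eq : ∀ a → suc (suc (2 * a) + 0 + 2 * (a + 0)) + 0 ≡ 2 * (suc (2 * a) + 0)
  eq = solve-∀

⊃R-≺ : ∀ (φ ψ : Formula Var) → (φ ∷ [] ⇒ ψ ∷ []) ≺ ([] ⇒ φ ⊃ ψ ∷ [])
⊃R-≺ φ ψ = slack _ (eq (weight φ) (weight ψ))
  where
  eq : ∀ a b → suc (a + 0 + 2 * (b + 0)) + (3 + 3 * a + 2 * b + 4 * a * b)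
             ≡ 2 * (2 * (suc a * suc b) + 0)
  eq = solve-∀

-- Proof search

Decided : Sequent Var → Set
Decided s = Provable s ⊎ ∃ (Refutes s)

-- When no rule instance decides Γ ⇒ Δ, each of its formulas contributes the
-- countermodels of the □⁻¹-premises of its rule as children of a common root;
-- P says that the root treats that formula correctly.
record Settled {Var : Set} (Γ : Multiset Var) (P : Tree Var → Set) : Set where
  constructor settle
  field
    candidates : List (Tree Var)
    forced     : All (_⊩* □⁻¹ Γ) candidates
    holds      : ∀ {Γ₀ n} {f : Fin n → Tree Var} → Γ₀ ↭ Γ → (∀ i → f i ⊩* □⁻¹ Γ) →
                 All (λ c → ∃ λ i → c ≡ f i) candidates → P (node Γ₀ f)

-- The middle case is a countermodel inherited from a premise at the same node; the last one calls
-- for a new root.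
Outcome : Sequent Var → (Tree Var → Set) → Set
Outcome s@(Γ ⇒ _) P = Provable s ⊎ (∃ (Refutes s) ⊎ Settled Γ P)

SmallerDecided : Sequent Var → Set
SmallerDecided s = ∀ {s′} → s′ ≺ s → Decided s′

private
  variable
    P Q : Tree Var → Set

-- Transport along permutations

≈-sym : s ≈ s′ → s′ ≈ s
≈-sym (π , ρ) = ↭-sym π , ↭-sym ρ

Provable-resp-≈ : s ≈ s′ → Provable s → Provable s′
Provable-resp-≈ (π , ρ) (derive r (π′ , ρ′) ps) = derive r (↭-trans π′ π , ↭-trans ρ′ ρ) ps

Refutes-resp-≈ : ∀ {t : Tree Var} → s ≈ s′ → Refutes s t → Refutes s′ t
Refutes-resp-≈ (π , ρ) (γ , δ) = All-resp-↭ π γ , All-resp-↭ ρ δ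

Decided-resp-≈ : s ≈ s′ → Decided s → Decided s′
Decided-resp-≈ e (inj₁ d)       = inj₁ (Provable-resp-≈ e d)
Decided-resp-≈ e (inj₂ (t , r)) = inj₂ (t , Refutes-resp-≈ e r)

Settled-resp-↭ : Γ ↭ Γ′ → Settled Γ P → Settled Γ′ P
Settled-resp-↭ π (settle cs γ h) =
  settle cs (All.map (All-resp-↭ (map⁺ unbox π)) γ)
    λ ρ γ′ → h (↭-trans ρ (↭-sym π)) (All-resp-↭ (map⁺ unbox (↭-sym π)) ∘ γ′)

Outcome-resp-≈ : s ≈ s′ → Outcome s P → Outcome s′ P
Outcome-resp-≈ e       (inj₁ d)              = inj₁ (Provable-resp-≈ e d)
Outcome-resp-≈ e       (inj₂ (inj₁ (t , r))) = inj₂ (inj₁ (t , Refutes-resp-≈ e r))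
Outcome-resp-≈ (π , _) (inj₂ (inj₂ h))       = inj₂ (inj₂ (Settled-resp-↭ π h))

≺-resp-≈ : ∀ {s₀} → s ≈ s′ → s₀ ≺ s → s₀ ≺ s′
≺-resp-≈ e (smaller lt) = smaller (<-≤-trans lt (≤-reflexive (size-≈ e)))

SmallerDecided-resp-≈ : s ≈ s′ → SmallerDecided s → SmallerDecided s′
SmallerDecided-resp-≈ e ih lt = ih (≺-resp-≈ (≈-sym e) lt)

-- Combining premises and outcomes

collect : ∀ {A : Set} {P : A → Set} {R : Set} {xs} →
          All (λ x → P x ⊎ R) xs → All P xs ⊎ R
collect []            = inj₁ []
collect (inj₂ r ∷ _)  = inj₂ r
collect (inj₁ p ∷ ps) with collect ps
... | inj₁ qs = inj₁ (p ∷ qs)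
... | inj₂ r  = inj₂ r

apply : ∀ {premises} {R : Set} → Rule premises s →
        All (λ s′ → Provable s′ ⊎ R) premises → Provable s ⊎ R
apply r ps with collect ps
... | inj₁ qs = inj₁ (derive r (↭-refl , ↭-refl) qs)
... | inj₂ x  = inj₂ x

-- For semantically invertible premises, whose countermodels already refute the conclusion.
invert : ∀ {R : Set} → (∀ {t} → Refutes s′ t → Refutes s t) →
         Decided s′ → Provable s′ ⊎ (∃ (Refutes s) ⊎ R)
invert h = map₂ (inj₁ ∘ ×-map₂ h)

settled : (∀ {Γ₀ n} {f : Fin n → Tree Var} → Γ₀ ↭ Γ → (∀ i → f i ⊩* □⁻¹ Γ) → P (node Γ₀ f)) →
          Outcome (Γ ⇒ Δ) P
settled h = inj₂ (inj₂ (settle [] [] λ π γ _ → h π γ))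

-- For premises over `□⁻¹ Γ`: a countermodel need not refute the conclusion, but as a child it makes
-- the new root treat the principal formula correctly.
jump : ∀ {R : Set} → (∀ {t} → Refutes s′ t → t ⊩* □⁻¹ Γ) →
       (∀ {Γ₀ n} {f : Fin n → Tree Var} → (∀ i → f i ⊩* □⁻¹ Γ) →
          (∃ λ i → Refutes s′ (f i)) → P (node Γ₀ f)) →
       Decided s′ → Provable s′ ⊎ (R ⊎ Settled Γ P)
jump {s′ = s′} k h = map₂ λ { (t , r) → inj₂
  (settle [ t ] (k r ∷ []) λ { _ γ ((i , eq) ∷ []) → h γ (i , subst (Refutes s′) eq r) }) }

Settled-map : (∀ {t} → P t → Q t) → Settled Γ P → Settled Γ Q
Settled-map g (settle cs γ h) = settle cs γ λ π α β → g (h π α β)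

-- `holds` tolerates children beyond its own candidates, so two candidate lists fit under one root.
Settled-× : Settled Γ P → Settled Γ Q → Settled Γ (λ t → P t × Q t)
Settled-× (settle cs γ h) (settle ds δ k) =
  settle (cs ++ ds) (All.++⁺ γ δ)
    λ π α β → h π α (All.++⁻ˡ cs β) , k π α (All.++⁻ʳ cs β)

Outcome-All : ∀ {R : Formula Var → Tree Var → Set} Θ → (∀ {φ} → φ ∈ Θ → Outcome s (R φ)) →
              Outcome s (λ t → All (λ φ → R φ t) Θ)
Outcome-All []      h = settled λ _ _ → []
Outcome-All (φ ∷ Θ) h with h (here refl) | Outcome-All Θ (h ∘ there)
... | inj₁ d        | _               = inj₁ d
... | inj₂ (inj₁ r) | _               = inj₂ (inj₁ r)
... | inj₂ (inj₂ _) | inj₁ d          = inj₁ d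
... | inj₂ (inj₂ _) | inj₂ (inj₁ r)   = inj₂ (inj₁ r)
... | inj₂ (inj₂ a) | inj₂ (inj₂ b)   = inj₂ (inj₂
  (Settled-map (λ { (x , xs) → x ∷ xs }) (Settled-× a b)))

-- The candidates become the children and `Γ` the label, so no variable outside `Γ` holds at the
-- root.
Settled-inhabited : Settled Γ P → ∃ P
Settled-inhabited {Γ = Γ} (settle cs γ h) =
  node Γ (lookup cs) ,
  h ↭-refl (λ i → All.lookup γ (∈-lookup i)) (All.tabulate λ c∈ → Any.index c∈ , lookup-index c∈)

∈⇒↭ : φ ∈ Γ → ∃ λ Γ′ → Γ ↭ φ ∷ Γ′
∈⇒↭ h with ∈-∃++ h
... | Γ₁ , Γ₂ , refl = Γ₁ ++ Γ₂ , shift _ Γ₁ Γ₂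

-- Decidable forcing and soundness

module _ (_≟_ : DecidableEquality Var) where

  var? : ∀ (p : Var) φ → Dec (var p ≡ φ)
  var? p (var q) = map′ (cong var) (λ { refl → refl }) (p ≟ q)
  var? p ⊥       = no λ ()
  var? p (_ ∧ _) = no λ ()
  var? p (_ ∨ _) = no λ ()
  var? p (_ ⊃ _) = no λ ()
  var? p (□ _)   = no λ ()

  infix 4 _⊩?_

  _⊩?_ : (t : Tree Var) (φ : Formula Var) → Dec (t ⊩ φ)
  node Γ f     ⊩? var p   = any? (var? p) Γ ×-dec all? λ i → f i ⊩? var p
  node _ _     ⊩? ⊥       = no λ ()
  t@(node _ _) ⊩? (φ ∧ ψ) = (t ⊩? φ) ×-dec (t ⊩? ψ)
  t@(node _ _) ⊩? (φ ∨ ψ) = (t ⊩? φ) ⊎-dec (t ⊩? ψ)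
  t@(node _ f) ⊩? (φ ⊃ ψ) = ((t ⊩? φ) →-dec (t ⊩? ψ)) ×-dec all? λ i → f i ⊩? (φ ⊃ ψ)
  node _ f     ⊩? (□ φ)   = all? λ i → f i ⊩? φ

  -- Decidability replaces excluded middle at the root: if `φ` fails there, the implication is
  -- vacuous; otherwise `h` yields `ψ` or a side formula.
  ⊃-right : ∀ {n} {f : Fin n → Tree Var} → (node Γ f ⊩ φ → Any (node Γ f ⊩_) (ψ ∷ Δ)) →
            (∀ i → f i ⊩ φ ⊃ ψ) → Any (node Γ f ⊩_) (φ ⊃ ψ ∷ Δ)
  ⊃-right {φ = φ} h later with _ ⊩? φ
  ... | no ¬a = here ((λ a → contradiction a ¬a) , later)
  ... | yes a with h a
  ...   | here b  = here (const b , later)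
  ...   | there d = there d

  rule-sound : ∀ {premises} {s : Sequent Var} → Rule premises s → All Valid premises → Valid s
  rule-sound ⊥L _ (node _ _) (() ∷ _)
  rule-sound IdP _ t (h ∷ _) = here h
  rule-sound ∧L (v ∷ []) t@(node _ _) ((a , b) ∷ γ) = v t (a ∷ b ∷ γ)
  rule-sound ∧R (v ∷ w ∷ []) t γ with v t γ | w t γ
  ... | there d | _       = there d
  ... | here _  | there d = there d
  ... | here a  | here b  = here (∧-intro t a b)
  rule-sound ∨L (v ∷ w ∷ []) t (h ∷ γ) with ∨-elim t h
  ... | inj₁ a = v t (a ∷ γ)
  ... | inj₂ b = w t (b ∷ γ)
  rule-sound ∨R (v ∷ []) t γ with v t γ
  ... | here a          = here (∨-introˡ t a)
  ... | there (here b)  = here (∨-introʳ t b)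
  ... | there (there d) = there d
  rule-sound ∧⊃L (v ∷ []) t (h ∷ γ) = v t (⊃-curry t h ∷ γ)
  rule-sound ∨⊃L (v ∷ []) t (h ∷ γ) = v t (∨-⊃ˡ t h ∷ ∨-⊃ʳ t h ∷ γ)
  rule-sound p⊃L (v ∷ []) t (a ∷ h ∷ γ) = v t (a ∷ ⊃-elim t h a ∷ γ)
  -- `löb` runs at each child; its hypothesis `□ φ` is the extra antecedent of the premise.
  rule-sound □R (v ∷ []) (node _ f) γ = here λ i →
    löb (λ t γ′ b → singleton-valid (v t (b ∷ γ′))) (f i) (persistent-□⁻¹ γ i)
  rule-sound □⊃L (v ∷ w ∷ []) t@(node _ f) (h ∷ γ) = w t (proj₁ h boxed ∷ γ)
    where
    -- Löb's assumption `□ φ` triggers the persisting `□ φ ⊃ ψ`, supplying the antecedent `ψ` of the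
    -- first premise.
    boxed = λ i → löb
      (λ t → λ { (h ∷ γ) b → singleton-valid (v t (b ∷ ⊃-elim t h b ∷ γ)) })
      (f i) (proj₂ h i ∷ persistent-□⁻¹ γ i)
  rule-sound ⊃R (v ∷ w ∷ []) t@(node _ f) γ = ⊃-right (λ a → v t (a ∷ γ)) λ i →
    ⊃-intro (λ t γ a → singleton-valid (w t (a ∷ γ))) (f i) (persistent-□⁻¹ γ i)
  -- As for `⊃R`, the first two premises give `φ ⊃ χ` or a formula of `Δ`; the former releases `ψ`
  -- for the third.
  rule-sound ⊃⊃L (v ∷ w ∷ u ∷ []) t@(node _ f) (h ∷ γ)
    with ⊃-right (λ a → v t (⊃-⊃-weaken t h ∷ a ∷ γ)) (λ i → ⊃-intro
           (λ t → λ { (h ∷ γ) a → singleton-valid (w t (⊃-⊃-weaken t h ∷ a ∷ γ)) })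
           (f i) (proj₂ h i ∷ persistent-□⁻¹ γ i))
  ... | here k  = u t (proj₁ h k ∷ γ)
  ... | there d = d

  sound  : {s : Sequent Var} → Provable s → Valid s
  sound* : {ss : List (Sequent Var)} → All Provable ss → All Valid ss
  sound (derive r (π , ρ) ps) t γ =
    Any-resp-↭ ρ (rule-sound r (sound* ps) t (All-resp-↭ (↭-sym π) γ))
  sound* []       = []
  sound* (p ∷ ps) = sound p ∷ sound* ps

  -- Search by the main connective

  left : ∀ (φ : Formula Var) {Γ Δ} → SmallerDecided (φ ∷ Γ ⇒ Δ) →
         Outcome (φ ∷ Γ ⇒ Δ) (_⊩ φ)
  left (var p) ih = settled λ π γ →
    ∈-resp-↭ (↭-sym π) (here refl) , λ i → All.head (γ i)
  left ⊥ ih = inj₁ (derive ⊥L (↭-refl , ↭-refl) [])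
  left (φ ∧ ψ) ih = apply ∧L
    ( invert (λ { {node _ _} (a ∷ b ∷ γ , δ) → (a , b) ∷ γ , δ })
        (ih (≺-replace (φ ∷ ψ ∷ []) [] [ φ ∧ ψ ] [] (∧L-≺ φ ψ) ≤-refl ≤-refl))
    ∷ [])
  left (φ ∨ ψ) ih = apply ∨L
    ( invert (λ { {node _ _} (a ∷ γ , δ) → inj₁ a ∷ γ , δ })
        (ih (≺-replace [ φ ] [] [ φ ∨ ψ ] [] (∨L-≺ˡ φ ψ) ≤-refl ≤-refl))
    ∷ invert (λ { {node _ _} (b ∷ γ , δ) → inj₂ b ∷ γ , δ })
        (ih (≺-replace [ ψ ] [] [ φ ∨ ψ ] [] (∨L-≺ʳ φ ψ) ≤-refl ≤-refl))
    ∷ [])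
  left (□ φ) ih = settled λ _ γ i → All.head (γ i)
  left (var p ⊃ φ) {Γ} {Δ} ih with any? (var? p) Γ
  -- Without `p` in the label the implication is vacuous at the root; the children force it because
  -- `unbox` leaves it unchanged.
  ... | no p∉ = settled λ π γ →
    (λ { (h , _) → contradiction (Any.tail (λ ()) (∈-resp-↭ π h)) p∉ }) , λ i → All.head (γ i)
  ... | yes p∈ with ∈⇒↭ p∈
  ...   | Γ′ , π = Outcome-resp-≈
    (↭-trans (swap _ _ ↭-refl) (prep _ (↭-sym π)) , ↭-refl)
    (apply p⊃L
      ( invert (λ { {t} (a ∷ b ∷ γ , δ) → a ∷ ⊃-const t b ∷ γ , δ })
          -- Since `var p` lies in `Γ`, the premise is `φ ∷ Γ ⇒ Δ` up to order.
          (Decided-resp-≈ (↭-trans (prep _ π) (swap _ _ ↭-refl) , ↭-refl)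
            (ih (≺-replace [ φ ] [] [ var p ⊃ φ ] [] {Δ = Δ} (⊃L-≺ (var p) φ) ≤-refl ≤-refl)))
      ∷ []))
  left (⊥ ⊃ φ) ih = settled λ _ γ → (λ ()) , λ i → All.head (γ i)
  left ((φ ∧ ψ) ⊃ χ) ih = apply ∧⊃L
    ( invert (λ { {t} (h ∷ γ , δ) → ⊃-uncurry t h ∷ γ , δ })
        (ih (≺-replace [ φ ⊃ (ψ ⊃ χ) ] [] [ (φ ∧ ψ) ⊃ χ ] [] (∧⊃L-≺ φ ψ χ) ≤-refl ≤-refl))
    ∷ [])
  left ((φ ∨ ψ) ⊃ χ) ih = apply ∨⊃L
    ( invert (λ { {t} (h ∷ k ∷ γ , δ) → ∨-⊃ t h k ∷ γ , δ })
        (ih (≺-replace (φ ⊃ χ ∷ ψ ⊃ χ ∷ []) [] [ (φ ∨ ψ) ⊃ χ ] [] (∨⊃L-≺ φ ψ χ) ≤-refl ≤-refl))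
    ∷ [])
  left ((φ ⊃ χ) ⊃ ψ) {Γ} ih = apply ⊃⊃L
    ( invert (λ { {t} (h ∷ a ∷ γ , ¬c ∷ δ) → ⊃-⊃-intro t h a ¬c ∷ γ , δ })
        (ih (≺-replace (χ ⊃ ψ ∷ φ ∷ []) [ χ ] [ (φ ⊃ χ) ⊃ ψ ] [] (⊃⊃L-≺ φ χ ψ) ≤-refl ≤-refl))
    ∷ jump (λ { {t} (h ∷ a ∷ γ , ¬c ∷ _) → ⊃-⊃-intro t h a ¬c ∷ γ })
        -- The child forces `φ` but not `χ`, so `φ ⊃ χ` fails at the root and the principal formula
        -- is vacuous there.
        (λ { {f = f} γ (i , _ ∷ a ∷ _ , ¬c ∷ _) →
             (λ { (_ , k) → contradiction (⊃-elim (f i) (k i) a) ¬c }) , λ i → All.head (γ i) })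
        (ih (≺-replace (χ ⊃ ψ ∷ φ ∷ []) [ χ ] [ (φ ⊃ χ) ⊃ ψ ] [] (⊃⊃L-≺ φ χ ψ) (weights-□⁻¹ Γ) z≤n))
    ∷ invert (λ { {t} (b ∷ γ , δ) → ⊃-const t b ∷ γ , δ })
        (ih (≺-replace [ ψ ] [] [ (φ ⊃ χ) ⊃ ψ ] [] (⊃L-≺ (φ ⊃ χ) ψ) ≤-refl ≤-refl))
    ∷ [])
  left (□ φ ⊃ ψ) {Γ} ih = apply □⊃L
    ( jump (λ { {t} (_ ∷ b ∷ γ , _) → ⊃-const t b ∷ γ })
        -- A child refuting `φ` falsifies `□ φ` at the root.
        (λ { γ (i , _ , ¬a ∷ _) → (λ h → contradiction (h i) ¬a) , λ i → All.head (γ i) })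
        (ih (≺-replace (□ φ ∷ ψ ∷ []) [ φ ] [ □ φ ⊃ ψ ] [] (□⊃L-≺ φ ψ) (weights-□⁻¹ Γ) z≤n))
    ∷ invert (λ { {t} (b ∷ γ , δ) → ⊃-const t b ∷ γ , δ })
        (ih (≺-replace [ ψ ] [] [ □ φ ⊃ ψ ] [] (⊃L-≺ (□ φ) ψ) ≤-refl ≤-refl))
    ∷ [])

  right : ∀ (φ : Formula Var) {Γ Δ} → SmallerDecided (Γ ⇒ φ ∷ Δ) →
          Outcome (Γ ⇒ φ ∷ Δ) (λ t → ¬ t ⊩ φ)
  right (var p) {Γ} ih with any? (var? p) Γ
  ... | no p∉  = settled λ { π _ (h , _) → contradiction (∈-resp-↭ π h) p∉ }
  ... | yes p∈ with ∈⇒↭ p∈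
  ...   | Γ′ , π = inj₁ (derive IdP (↭-sym π , ↭-refl) [])
  right ⊥ ih = settled λ _ _ ()
  right (φ ∧ ψ) ih = apply ∧R
    ( invert (λ { {node _ _} (γ , ¬a ∷ δ) → γ , (¬a ∘ proj₁) ∷ δ })
        (ih (≺-replace [] [ φ ] [] [ φ ∧ ψ ] (∧R-≺ˡ φ ψ) ≤-refl ≤-refl))
    ∷ invert (λ { {node _ _} (γ , ¬b ∷ δ) → γ , (¬b ∘ proj₂) ∷ δ })
        (ih (≺-replace [] [ ψ ] [] [ φ ∧ ψ ] (∧R-≺ʳ φ ψ) ≤-refl ≤-refl))
    ∷ [])
  right (φ ∨ ψ) ih = apply ∨R
    ( invert (λ { {node _ _} (γ , ¬a ∷ ¬b ∷ δ) → γ , (λ { (inj₁ a) → ¬a a ; (inj₂ b) → ¬b b }) ∷ δ })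
        (ih (≺-replace [] (φ ∷ ψ ∷ []) [] [ φ ∨ ψ ] (∨R-≺ φ ψ) ≤-refl ≤-refl))
    ∷ [])
  right (φ ⊃ ψ) {Γ} ih = apply ⊃R
    ( invert (λ { {t} (a ∷ γ , ¬b ∷ δ) → γ , (λ h → ¬b (⊃-elim t h a)) ∷ δ })
        (ih (≺-replace [ φ ] [ ψ ] [] [ φ ⊃ ψ ] (⊃R-≺ φ ψ) ≤-refl ≤-refl))
    ∷ jump (λ { (_ ∷ γ , _) → γ })
        (λ { {f = f} _ (i , a ∷ _ , ¬b ∷ _) (_ , h) → ¬b (⊃-elim (f i) (h i) a) })
        (ih (≺-replace [ φ ] [ ψ ] [] [ φ ⊃ ψ ] (⊃R-≺ φ ψ) (weights-□⁻¹ Γ) z≤n))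
    ∷ [])
  right (□ φ) {Γ} ih = apply □R
    ( jump (λ { (_ ∷ γ , _) → γ })
        (λ { _ (i , _ , ¬a ∷ _) h → ¬a (h i) })
        (ih (≺-replace [ □ φ ] [ φ ] [] [ □ φ ] (□R-≺ φ) (weights-□⁻¹ Γ) z≤n))
    ∷ [])

  -- Each formula is permuted to the front and tried. If none proves or refutes the sequent, all
  -- candidates joined under one root form a countermodel.
  decide : ∀ (s : Sequent Var) → Acc _<_ (size s) → Decided s
  decide s@(Γ ⇒ Δ) (acc rec)
    with Outcome-All {s = s} Γ on-left | Outcome-All {s = s} Δ on-right
    where
    ih : SmallerDecided s
    ih (smaller lt) = decide _ (rec lt)

    on-left : φ ∈ Γ → Outcome s (_⊩ φ)
    on-left φ∈ with ∈⇒↭ φ∈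
    ... | _ , π = Outcome-resp-≈ (↭-sym π , ↭-refl)
                    (left _ (SmallerDecided-resp-≈ (π , ↭-refl) ih))

    on-right : φ ∈ Δ → Outcome s (λ t → ¬ t ⊩ φ)
    on-right φ∈ with ∈⇒↭ φ∈
    ... | _ , π = Outcome-resp-≈ (↭-refl , ↭-sym π)
                    (right _ (SmallerDecided-resp-≈ (↭-refl , π) ih))
  ... | inj₁ d        | _             = inj₁ d
  ... | inj₂ (inj₁ r) | _             = inj₂ r
  ... | inj₂ (inj₂ _) | inj₁ d        = inj₁ d
  ... | inj₂ (inj₂ _) | inj₂ (inj₁ r) = inj₂ r
  ... | inj₂ (inj₂ a) | inj₂ (inj₂ b) = inj₂ (Settled-inhabited (Settled-× a b))

proposition5 : (Var : Set) → DecidableEquality Var → Var ⤖ ℕ →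
    (Γ Δ : Multiset Var) (φ : Formula Var) →
    Provable (Γ ⇒ φ ∷ Δ) → Provable (φ ∷ Γ ⇒ Δ) → Provable (Γ ⇒ Δ)
proposition5 Var _≟_ _ Γ Δ φ d e with decide _≟_ (Γ ⇒ Δ) (<-wellFounded _)
... | inj₁ provable    = provable
-- As `t` forces nothing in `Δ`, the first premise makes it force `φ`, contrary to the second.
... | inj₂ (t , γ , δ) with sound _≟_ d t γ
...   | here a  = contradiction (sound _≟_ e t (a ∷ γ)) (All.All¬⇒¬Any δ)
...   | there b = contradiction b (All.All¬⇒¬Any δ)
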